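{- Let $r\geq 3$ and $k\geq 1$ be integers, let $n=kr+1$, and let $\mathcal{F}(n,r)=\binom{[n]}{2}\setminus\binom{[n]}{2}_{r\text{ -stab}}$ be the family of all $2$-subsets of $[n]$ that are not $r$-stable. Then $$\chi\left(\mathrm{KG}^r\left(\mathcal{F}(n,r)_{r\text{ -stab}}\right)\right)<\left\lceil\frac{cd_r\left(\mathcal{F}(n,r)\right)}{r-1}\right\rceil .$$ Consequently, the following assertion is false: for every $r\geq 3$ and every set system $\mathcal{F}$ on a ground set $[n]$, $\chi\left(\mathrm{KG}^r\left(\mathcal{F}_{r\text{ -stab}}\right)\right)\geq\left\lceil\frac{cd_r(\mathcal{F})}{r-1}\right\rceil$.
   Context: $[n]=\{1,\ldots,n\}$ and $\binom{[n]}{2}$ is the set of all $2$-element subsets of $[n]$. A hypergraph $\mathcal{H}=(V,E)$ consists of a finite set $V$ of vertices and a set $E$ of non-empty subsets of $V$ called edges. An $m$-coloring of $\mathcal{H}$ is a map $c:V\to\{1,\ldots,m\}$ with no monochromatic edge, i.e. $|c(e)|\geq 2$ for all $e\in E$; $\mathcal{H}$ is $m$-colorable if it admits an $m$-coloring. The chromatic number $\chi(\mathcal{H})$ is the minimum integer $m\ge 0$ such that $\mathcal{H}$ is $m$-colorable (so it is $0$ for the hypergraph with no vertices). A set system $\mathcal{F}$ of subsets of $[n]$ is identified with the hypergraph $([n],\mathcal{F})$. For $r\geq 2$, the $r$-colorability defect $cd_r(\mathcal{H})$ is the minimum number of vertices that must be removed from $V$ so that the induced hypergraph on the remaining vertices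 (whose edges are the edges of $\mathcal{H}$ contained in the remaining vertex set) is $r$-colorable. For a set system $\mathcal{F}$, $\mathrm{KG}^r(\mathcal{F})$ is the $r$-uniform hypergraph whose vertices are the elements of $\mathcal{F}$ and whose edges are all sets $\{A_1,\ldots,A_r\}$ of $r$ vertices with $A_i\cap A_j=\emptyset$ for all $i\neq j$. A subset $\sigma\subseteq[n]$ is $s$-stable if $s\leq|i-j|\leq n-s$ for all distinct $i,j\in\sigma$. For a family $\mathcal{F}$ of subsets of $[n]$, $\mathcal{F}_{s\text{ -stab}}$ denotes the set of all $s$-stable members of $\mathcal{F}$. -}

module Defs where

open import Data.Bool.Properties using () renaming (_≟_ to _≟ᵇ_)
open import Data.Empty using (⊥-elim)
open import Data.Fin using (Fin; zero; toℕ; finToFun; funToFin)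
open import Data.Fin.Properties
  using (¬Fin0; any?; all?; finToFun-funToFin) renaming (_≟_ to _≟ᶠ_)
open import Data.Fin.Subset
  using (Subset; inside; outside; _∈_; _⊆_; _∩_; _─_; ⊤; ⁅_⁆; ∣_∣; Nonempty; Empty)
open import Data.Fin.Subset.Properties
  using (_∈?_; _⊆?_; nonempty?; anySubset?; Empty-unique; ∣⊥∣≡0; ∣⁅x⁆∣≡1;
         p⊆q⇒∣p∣≤∣q∣; x∈⁅x⁆; ∈⊤; ⊆⊤; x∈p∧x∉q⇒x∈p─q; p─q⊆p)
open import Data.List using (List; []; _∷_; length; lookup; filter; cartesianProductWith)
open import Data.List.Membership.Propositional using () renaming (_∈_ to _∈ˡ_)
open import Data.List.Membership.DecPropositional using () renaming (_∈?_ to mem?)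
open import Data.List.Relation.Unary.All as All using (All; []; _∷_)
open import Data.List.Relation.Unary.All.Properties using (all-filter)
  renaming (filter⁺ to All-filter⁺)
open import Data.List.Relation.Unary.AllPairs using ([]; _∷_)
open import Data.List.Relation.Unary.Unique.Propositional using (Unique)
open import Data.List.Relation.Unary.Unique.Propositional.Properties
  using (cartesianProductWith⁺) renaming (filter⁺ to Unique-filter⁺)
open import Data.Nat
  using (ℕ; zero; suc; _+_; _^_; _*_; _∸_; _≤_; _<_; z≤n; s≤s; ∣_-_∣; _/_; NonZero; NonTrivial;
         nonTrivial⇒n>1; >-nonZero)
open import Data.Nat.Properties using (≤-trans; ≤-reflexive; <-irrefl; m<n⇒0<n∸m)
  renaming (_≟_ to _≟ⁿ_; _≤?_ to _≤?ⁿ_)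
open import Data.Product using (∃; _×_; _,_; proj₁; proj₂)
open import Data.Vec using ([]; _∷_; there)
open import Data.Vec.Properties using (∷-injective; ≡-dec)
open import Data.Vec.Properties.WithK using ([]=-irrelevant)
open import Function using (_∘_)
open import Level using (0ℓ)
open import Relation.Binary.PropositionalEquality
  using (_≡_; _≢_; refl; sym; trans; cong; subst)
open import Relation.Nullary using (¬_; Dec; yes; no)
open import Relation.Nullary.Decidable using (map′; _×-dec_; _→-dec_; ¬?)
open import Relation.Unary using (Pred; Decidable)

private
  variable
    n : ℕ

------------------------------------------------------------------------
-- Arithmetic

record Minimum (P : Pred ℕ 0ℓ) : Set where
  field
    value    : ℕ
    attained : P value
    minimal  : ∀ m → P m → value ≤ m

minimum : {P : Pred ℕ 0ℓ} → Decidable P → ∀ k → P k → Minimum P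
minimum P? zero p = record { value = 0 ; attained = p ; minimal = λ _ _ → z≤n }
minimum {P} P? (suc k) p with P? 0
... | yes p₀ = record { value = 0 ; attained = p₀ ; minimal = λ _ _ → z≤n }
... | no ¬p₀ = record { value = suc M.value ; attained = M.attained ; minimal = above }
  where
  module M = Minimum (minimum (P? ∘ suc) k p)

  above : ∀ m → P m → suc M.value ≤ m
  above zero    p₀ = ⊥-elim (¬p₀ p₀)
  above (suc m) pₘ = s≤s (M.minimal m pₘ)

⌈_/_⌉ : (m d : ℕ) .{{_ : NonZero d}} → ℕ
⌈ m / d ⌉ = (m + (d ∸ 1)) / d

⌈_/[_-1]⌉ : (m r : ℕ) .{{_ : NonTrivial r}} → ℕ
⌈ m /[ r -1]⌉ = ⌈ m / r ∸ 1 ⌉ {{>-nonZero (m<n⇒0<n∸m (nonTrivial⇒n>1 r))}}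

------------------------------------------------------------------------
-- Hypergraphs

-- The vertices lie in an ambient Fin N, so that an induced subhypergraph
-- only shrinks V. Decidability of E expresses that E is a finite set.
record Hypergraph (N : ℕ) : Set₁ where
  field
    V          : Subset N
    E          : Pred (Subset N) 0ℓ
    E?         : Decidable E
    E-nonempty : ∀ {e} → E e → Nonempty e
    E⊆V        : ∀ {e} → E e → e ⊆ V

  Vertex : Set
  Vertex = ∃ λ x → x ∈ V

  Monochromatic : ∀ {m} → (Vertex → Fin m) → Subset N → Set
  Monochromatic c e = ∀ (v w : Vertex) → proj₁ v ∈ e → proj₁ w ∈ e → c v ≡ c w

  IsColoring : ∀ m → (Vertex → Fin m) → Set
  IsColoring m c = ∀ e → E e → ¬ Monochromatic c e

  Colorable : Pred ℕ 0ℓ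
  Colorable m = ∃ (IsColoring m)

module _ {N : ℕ} (H : Hypergraph N) where
  open Hypergraph H

  private
    -- For m ≥ 1 a coloring of V extends to the ambient Fin N, and the maps
    -- Fin N → Fin m are enumerated by Fin (m ^ N).
    Mono : ∀ {m} → (Fin N → Fin m) → Subset N → Set
    Mono c e = ∀ x y → x ∈ e → y ∈ e → c x ≡ c y

    Good : ∀ {m} → (Fin N → Fin m) → Set
    Good c = ¬ ∃ λ e → E e × Mono c e

    good? : ∀ {m} → (c : Fin N → Fin m) → Dec (Good c)
    good? c = ¬? (anySubset? λ e → E? e ×-dec
      all? λ x → all? λ y → (x ∈? e) →-dec ((y ∈? e) →-dec (c x ≟ᶠ c y)))

    extend : ∀ {m} → (Vertex → Fin (suc m)) → Fin N → Fin (suc m)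
    extend c x with x ∈? V
    ... | yes x∈V = c (x , x∈V)
    ... | no  _   = zero

    extend-≡ : ∀ {m} (c : Vertex → Fin (suc m)) (v : Vertex) → extend c (proj₁ v) ≡ c v
    extend-≡ c (x , x∈V) with x ∈? V
    ... | yes p  = cong (λ q → c (x , q)) ([]=-irrelevant p x∈V)
    ... | no x∉V = ⊥-elim (x∉V x∈V)

    good⇒colorable : ∀ {m} (c : Fin N → Fin m) → Good c → Colorable m
    good⇒colorable c g = c ∘ proj₁ , λ e Ee mono →
      g (e , Ee , λ x y x∈e y∈e → mono (x , E⊆V Ee x∈e) (y , E⊆V Ee y∈e) x∈e y∈e)

    coloring⇒good : ∀ {m} (c : Vertex → Fin (suc m)) → IsColoring (suc m) c →
                    Good (finToFun (funToFin (extend c)))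
    coloring⇒good {m} c ok (e , Ee , mono) = ok e Ee λ v w v∈e w∈e →
      trans (sym (eq v)) (trans (mono (proj₁ v) (proj₁ w) v∈e w∈e) (eq w))
      where
      eq : ∀ v → finToFun (funToFin (extend c)) (proj₁ v) ≡ c v
      eq v = trans (finToFun-funToFin (extend c) (proj₁ v)) (extend-≡ c v)

  empty⇒colorable : Empty V → ∀ m → Colorable m
  empty⇒colorable V-empty m =
    (λ v → ⊥-elim (V-empty v)) ,
    λ e Ee _ → let (x , x∈e) = E-nonempty Ee in V-empty (x , E⊆V Ee x∈e)

  colorable? : Decidable Colorable
  colorable? zero with nonempty? V
  ... | yes v      = no λ (c , _) → ¬Fin0 (c v)
  ... | no V-empty = yes (empty⇒colorable V-empty 0)
  colorable? (suc m) =
    map′ (λ (k , g) → good⇒colorable (finToFun k) g)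
         (λ (c , ok) → funToFin (extend c) , coloring⇒good c ok)
         (any? {suc m ^ N} λ k → good? (finToFun k))

  chromaticNumber : ∃ Colorable → Minimum Colorable
  chromaticNumber (k , col) = minimum colorable? k col

-- A hypergraph with a one-element edge has no coloring at all, so χ takes the
-- existence of some coloring as an argument.
χ : ∀ {N} (H : Hypergraph N) → ∃ (Hypergraph.Colorable H) → ℕ
χ H col = Minimum.value (chromaticNumber H col)

-- The subhypergraph induced on the vertices outside R.
remove : ∀ {N} → Hypergraph N → Subset N → Hypergraph N
remove H R = record
  { V          = V ─ R
  ; E          = λ e → E e × e ⊆ V ─ R
  ; E?         = λ e → E? e ×-dec (e ⊆? V ─ R)
  ; E-nonempty = E-nonempty ∘ proj₁
  ; E⊆V        = proj₂
  }
  where open Hypergraph H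

module _ {N : ℕ} (r : ℕ) (H : Hypergraph N) where
  open Hypergraph H

  ColorableAfterRemoving : Pred ℕ 0ℓ
  ColorableAfterRemoving d =
    ∃ λ R → R ⊆ V × ∣ R ∣ ≡ d × Hypergraph.Colorable (remove H R) r

  colorableAfterRemoving? : Decidable ColorableAfterRemoving
  colorableAfterRemoving? d = anySubset? λ R →
    (R ⊆? V) ×-dec ((∣ R ∣ ≟ⁿ d) ×-dec colorable? (remove H R) r)

  colorableAfterRemovingAll : ColorableAfterRemoving ∣ V ∣
  colorableAfterRemovingAll =
    V , (λ x∈V → x∈V) , refl , empty⇒colorable (remove H V) (λ (_ , x∈) → p─p-empty V x∈) r
    where
    p─p-empty : ∀ {k} (p : Subset k) {x} → ¬ (x ∈ p ─ p)
    p─p-empty (inside  ∷ p) (there x∈) = p─p-empty p x∈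
    p─p-empty (outside ∷ p) (there x∈) = p─p-empty p x∈

  colorabilityDefect : Minimum ColorableAfterRemoving
  colorabilityDefect = minimum colorableAfterRemoving? ∣ V ∣ colorableAfterRemovingAll

  cd : ℕ
  cd = Minimum.value colorabilityDefect

------------------------------------------------------------------------
-- Set systems

-- Members are nonempty because a set system is identified with a hypergraph.
record SetSystem (n : ℕ) : Set where
  field
    members  : List (Subset n)
    unique   : Unique members
    nonempty : All Nonempty members

  size : ℕ
  size = length members

open SetSystem public

hypergraph : SetSystem n → Hypergraph n
hypergraph F = record
  { V          = ⊤
  ; E          = _∈ˡ members F
  ; E?         = λ A → mem? (≡-dec _≟ᵇ_) A (members F)
  ; E-nonempty = All.lookup (nonempty F)
  ; E⊆V        = λ _ → ⊆⊤
  }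

select : {P : Pred (Subset n) 0ℓ} → Decidable P → SetSystem n → SetSystem n
select P? F = record
  { members  = filter P? (members F)
  ; unique   = Unique-filter⁺ P? (unique F)
  ; nonempty = All-filter⁺ P? (nonempty F)
  }

infixl 6 _∖_

_∖_ : SetSystem n → SetSystem n → SetSystem n
F ∖ G = select (λ A → ¬? (mem? (≡-dec _≟ᵇ_) A (members G))) F

powerset : ∀ n → List (Subset n)
powerset zero    = [] ∷ []
powerset (suc n) = cartesianProductWith _∷_ (inside ∷ outside ∷ []) (powerset n)

powerset-unique : ∀ n → Unique (powerset n)
powerset-unique zero    = [] ∷ []
powerset-unique (suc n) =
  cartesianProductWith⁺ _∷_ ∷-injective (((λ ()) ∷ []) ∷ [] ∷ []) (powerset-unique n)

0<∣p∣⇒nonempty : {p : Subset n} → 0 < ∣ p ∣ → Nonempty p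
0<∣p∣⇒nonempty {n} {p} 0<∣p∣ with nonempty? p
... | yes ne = ne
... | no  em = ⊥-elim (<-irrefl (sym (trans (cong ∣_∣ (Empty-unique em)) (∣⊥∣≡0 n))) 0<∣p∣)

pairs : ∀ n → SetSystem n
pairs n = record
  { members  = filter pair? (powerset n)
  ; unique   = Unique-filter⁺ pair? (powerset-unique n)
  ; nonempty = All.map (λ ∣A∣≡2 → 0<∣p∣⇒nonempty (subst (0 <_) (sym ∣A∣≡2) (s≤s z≤n)))
                       (all-filter pair? (powerset n))
  }
  where
  pair? : (A : Subset n) → Dec (∣ A ∣ ≡ 2)
  pair? A = ∣ A ∣ ≟ⁿ 2

-- [n] is represented by Fin n (shifted by one), and |i - j| ≤ n - s is written
-- additively to avoid truncated subtraction.
Stable : ℕ → Subset n → Set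
Stable {n} s σ = ∀ i j → i ∈ σ → j ∈ σ → i ≢ j →
  s ≤ ∣ toℕ i - toℕ j ∣ × ∣ toℕ i - toℕ j ∣ + s ≤ n

stable? : ∀ s → Decidable (Stable {n} s)
stable? {n} s σ = all? λ i → all? λ j →
  (i ∈? σ) →-dec ((j ∈? σ) →-dec (¬? (i ≟ᶠ j) →-dec
    ((s ≤?ⁿ ∣ toℕ i - toℕ j ∣) ×-dec (∣ toℕ i - toℕ j ∣ + s ≤?ⁿ n))))

stab : ℕ → SetSystem n → SetSystem n
stab s = select (stable? s)

nonstablePairs : ∀ n → ℕ → SetSystem n
nonstablePairs n r = pairs n ∖ stab r (pairs n)

------------------------------------------------------------------------
-- Kneser hypergraphs

-- The vertex i stands for the i-th member of F; members are listed without
-- repetition, so sets of vertices correspond to sets of members.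
module _ (r : ℕ) .{{_ : NonTrivial r}} (F : SetSystem n) where

  KGEdge : Pred (Subset (size F)) 0ℓ
  KGEdge S = ∣ S ∣ ≡ r × (∀ i j → i ∈ S → j ∈ S → i ≢ j →
    Empty (lookup (members F) i ∩ lookup (members F) j))

  KGEdge? : Decidable KGEdge
  KGEdge? S = (∣ S ∣ ≟ⁿ r) ×-dec (all? λ i → all? λ j →
    (i ∈? S) →-dec ((j ∈? S) →-dec (¬? (i ≟ᶠ j) →-dec ¬? (nonempty? _))))

  KG : Hypergraph (size F)
  KG = record
    { V          = ⊤
    ; E          = KGEdge
    ; E?         = KGEdge?
    ; E-nonempty = λ (∣S∣≡r , _) → 0<∣p∣⇒nonempty
        (subst (0 <_) (sym ∣S∣≡r) (≤-trans (s≤s z≤n) (nonTrivial⇒n>1 r)))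
    ; E⊆V        = λ _ → ⊆⊤
    }

  KG-colorable : ∃ (Hypergraph.Colorable KG)
  KG-colorable = size F , proj₁ , λ S edge mono →
    let (x , x∈S) = Hypergraph.E-nonempty KG edge
        S⊆⁅x⁆ : S ⊆ ⁅ x ⁆
        S⊆⁅x⁆ {y} y∈S = subst (_∈ ⁅ x ⁆) (mono (x , ∈⊤) (y , ∈⊤) x∈S y∈S) (x∈⁅x⁆ x)
        ∣S∣≤1 = ≤-trans (p⊆q⇒∣p∣≤∣q∣ S⊆⁅x⁆) (≤-reflexive (∣⁅x⁆∣≡1 x))
    in <-irrefl refl (≤-trans (nonTrivial⇒n>1 r) (subst (_≤ 1) (proj₁ edge) ∣S∣≤1))

  χ-KG : ℕ
  χ-KG = χ KG KG-colorable

{-# OPTIONS --safe #-}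

-- No member of F(n,r) is r-stable, so the Kneser hypergraph has no vertices and
-- its chromatic number is 0. On the other hand F(n,r) has positive defect. In an
-- r-coloring c of the graph F(n,r), any two of r + 1 consecutive elements
-- x, …, x + r are adjacent except possibly the two ends, so by the pigeonhole
-- principle c (x + r) = c x. Hence c 0 = c r = … = c (k r), but 0 and
-- k r = n - 1 are adjacent.
module Submission where

open import Defs
open import Data.Bool.Properties using () renaming (_≟_ to _≟ᵇ_)
open import Data.Empty using (⊥-elim)
open import Data.Fin using (Fin; zero; suc; toℕ; fromℕ<) renaming (_<_ to _<ᶠ_)
open import Data.Fin.Properties
  using (toℕ<n; toℕ≤pred[n]; toℕ-fromℕ<; toℕ-injective; pigeonhole)
open import Data.Fin.Subset using (Subset; inside; outside; _∈_; _∉_; _∪_; ⁅_⁆; ∣_∣)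
open import Data.Fin.Subset.Properties
  using (∪-identityˡ; ∪-identityʳ; ∣⁅x⁆∣≡1; x∈p∪q⁺; x∈p∪q⁻; x∈⁅x⁆; x∈⁅y⁆⇒x≡y;
         x∈p⇒∣p-x∣<∣p∣; x∈p∧x∉q⇒x∈p─q; ∈⊤)
open import Data.List using (_∷_; [])
open import Data.List.Membership.DecPropositional using () renaming (_∈?_ to mem?)
open import Data.List.Membership.Propositional using () renaming (_∈_ to _∈ˡ_; _∉_ to _∉ˡ_)
open import Data.List.Membership.Propositional.Properties
  using (∈-filter⁺; ∈-filter⁻; ∈-cartesianProductWith⁺; ∈-lookup)
open import Data.List.Relation.Unary.Any using (here; there)
open import Data.Nat
  using (ℕ; zero; suc; _+_; _*_; _∸_; _≤_; _≥_; _<_; _>_; z<s; ∣_-_∣; _<?_; NonZero;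
         NonTrivial; nonTrivial⇒n>1; >-nonZero)
open import Data.Nat.DivMod using (m≥n⇒m/n>0)
open import Data.Nat.Properties
  using (≤-refl; ≤-reflexive; ≤-trans; ≤-antisym; ≤-<-trans; <-≤-trans; <⇒≤; <⇒≱; <⇒≢; ≮⇒≥;
         n≮0; n≢0⇒n>0; n≤0⇒n≡0; n<1+n; m<n⇒0<n; m<m+n; m≤n+m; m∸n≤m; m<n⇒0<n∸m;
         m+[n∸m]≡n; +-comm; +-identityʳ; +-monoˡ-≤; +-monoʳ-≤; +-cancelˡ-≡; +-cancelˡ-≤; +-cancelʳ-≤; *-mono-≤;
         m≤n⇒∣m-n∣≡n∸m; ∣m+n-m+o∣≡∣n-o∣; module ≤-Reasoning)
open import Data.Product using (∃₂; _×_; _,_; proj₂)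
open import Data.Sum using (_⊎_; inj₁; inj₂; map)
open import Data.Vec using ([]; _∷_)
open import Data.Vec.Properties using (≡-dec)
open import Data.Vec.Properties.WithK using ([]=-irrelevant)
open import Function using (_∘_)
open import Relation.Binary.PropositionalEquality
  using (_≡_; _≢_; refl; sym; trans; cong; cong₂; subst; module ≡-Reasoning)
open import Relation.Nullary using (¬_; ¬?; yes; no)

private
  variable
    n : ℕ

⌈/-1⌉>0 : ∀ m r .{{_ : NonTrivial r}} → 0 < m → 0 < ⌈ m /[ r -1]⌉
⌈/-1⌉>0 m r 0<m = ceil>0 (r ∸ 1) {{>-nonZero (m<n⇒0<n∸m (nonTrivial⇒n>1 r))}}
  where
  ceil>0 : ∀ d .{{_ : NonZero d}} → 0 < ⌈ m / d ⌉
  -- From `0 < m` the numerator `m + d′` is at least `1 + d′`, the divisor itself.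
  ceil>0 d@(suc d′) = m≥n⇒m/n>0 {m + d′} {d} (+-monoˡ-≤ d′ 0<m)

stab-∖-stab : ∀ s (F : SetSystem n) A → A ∉ˡ members (stab s (F ∖ stab s F))
stab-∖-stab s F A A∈ =
  let A∈F∖ , stable  = ∈-filter⁻ (stable? s) {xs = members (F ∖ stab s F)} A∈
      A∈F  , A∉stab  = ∈-filter⁻ (λ B → ¬? (mem? (≡-dec _≟ᵇ_) B (members (stab s F))))
                                 {xs = members F} A∈F∖
  in A∉stab (∈-filter⁺ (stable? s) A∈F stable)

-- Without vertices the empty map is already a coloring with 0 colors.
χ-KG-memberless : ∀ r .{{_ : NonTrivial r}} (F : SetSystem n) →
                  (∀ A → A ∉ˡ members F) → χ-KG r F ≡ 0
χ-KG-memberless r F none = n≤0⇒n≡0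
  (Minimum.minimal (chromaticNumber (KG r F) (KG-colorable r F)) 0
    (empty⇒colorable (KG r F) (λ (i , _) → none _ (∈-lookup {xs = members F} i)) 0))

∈-powerset : (A : Subset n) → A ∈ˡ powerset n
∈-powerset []      = here refl
∈-powerset (b ∷ A) = ∈-cartesianProductWith⁺ _∷_ (∈-sides b) (∈-powerset A)
  where
  ∈-sides : ∀ b → b ∈ˡ (inside ∷ outside ∷ [])
  ∈-sides inside  = here refl
  ∈-sides outside = there (here refl)

∣⁅x⁆∪⁅y⁆∣≡2 : {x y : Fin n} → x ≢ y → ∣ ⁅ x ⁆ ∪ ⁅ y ⁆ ∣ ≡ 2
∣⁅x⁆∪⁅y⁆∣≡2 {x = zero}  {zero}  x≢y = ⊥-elim (x≢y refl)
∣⁅x⁆∪⁅y⁆∣≡2 {x = zero}  {suc y} x≢y =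
  cong suc (trans (cong ∣_∣ (∪-identityˡ ⁅ y ⁆)) (∣⁅x⁆∣≡1 y))
∣⁅x⁆∪⁅y⁆∣≡2 {x = suc x} {zero}  x≢y =
  cong suc (trans (cong ∣_∣ (∪-identityʳ ⁅ x ⁆)) (∣⁅x⁆∣≡1 x))
∣⁅x⁆∪⁅y⁆∣≡2 {x = suc x} {suc y} x≢y = ∣⁅x⁆∪⁅y⁆∣≡2 (x≢y ∘ cong suc)

-- The condition that `Stable s` imposes on each pair of distinct elements. Distinct points that are
-- not `Far` are thus the adjacent ones in the graph to be colored.
Far : ℕ → Fin n → Fin n → Set
Far {n} s x y = s ≤ ∣ toℕ x - toℕ y ∣ × ∣ toℕ x - toℕ y ∣ + s ≤ n

⁅x⁆∪⁅y⁆∈nonstablePairs : ∀ s {x y : Fin n} → x ≢ y → ¬ Far s x y →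
                         ⁅ x ⁆ ∪ ⁅ y ⁆ ∈ˡ members (nonstablePairs n s)
⁅x⁆∪⁅y⁆∈nonstablePairs {n} s {x} {y} x≢y near =
  ∈-filter⁺ _ (∈-filter⁺ _ (∈-powerset _) (∣⁅x⁆∪⁅y⁆∣≡2 x≢y)) λ ∈stab →
    near (proj₂ (∈-filter⁻ (stable? s) {xs = members (pairs n)} ∈stab) x y
      (x∈p∪q⁺ (inj₁ (x∈⁅x⁆ x))) (x∈p∪q⁺ (inj₂ (x∈⁅x⁆ y))) x≢y)

∣p∣≡0⇒x∉p : {p : Subset n} → ∣ p ∣ ≡ 0 → ∀ {x} → x ∉ p
∣p∣≡0⇒x∉p ∣p∣≡0 x∈p = n≮0 (<-≤-trans (x∈p⇒∣p-x∣<∣p∣ x∈p) (≤-reflexive ∣p∣≡0))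

module _ {r n} (f : Fin n → Fin r)
         (proper : ∀ {x y} → x ≢ y → ¬ Far r x y → f x ≢ f y) where

  r-periodic : ∀ (x y : Fin n) → toℕ y ≡ toℕ x + r → f x ≡ f y
  r-periodic x y y≡x+r = periodic (pigeonhole (n<1+n r) (f ∘ shift))
    where
    x+_<n : (j : Fin (suc r)) → toℕ x + toℕ j < n
    -- Since `j` is at most `r`, no point of the window passes `y`, so the window stays inside
    -- `Fin n`.
    x+ j <n = ≤-<-trans (+-monoʳ-≤ (toℕ x) (toℕ≤pred[n] j)) (subst (_< n) y≡x+r (toℕ<n y))

    shift : Fin (suc r) → Fin n
    shift j = fromℕ< (x+ j <n)

    toℕ-shift : ∀ j → toℕ (shift j) ≡ toℕ x + toℕ j
    toℕ-shift j = toℕ-fromℕ< (x+ j <n)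

    dist-shift : ∀ {a b} → a <ᶠ b → ∣ toℕ (shift a) - toℕ (shift b) ∣ ≡ toℕ b ∸ toℕ a
    dist-shift {a} {b} a<b = begin
      ∣ toℕ (shift a) - toℕ (shift b) ∣      ≡⟨ cong₂ ∣_-_∣ (toℕ-shift a) (toℕ-shift b) ⟩
      ∣ toℕ x + toℕ a - toℕ x + toℕ b ∣      ≡⟨ ∣m+n-m+o∣≡∣n-o∣ (toℕ x) (toℕ a) (toℕ b) ⟩
      ∣ toℕ a - toℕ b ∣                      ≡⟨ m≤n⇒∣m-n∣≡n∸m (<⇒≤ a<b) ⟩
      toℕ b ∸ toℕ a                          ∎
      where open ≡-Reasoning

    shift-≢ : ∀ {a b} → a <ᶠ b → shift a ≢ shift b
    shift-≢ {a} {b} a<b eq = <⇒≢ a<b (+-cancelˡ-≡ (toℕ x) _ _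
      (trans (sym (toℕ-shift a)) (trans (cong toℕ eq) (toℕ-shift b))))

    periodic : (∃₂ λ a b → a <ᶠ b × f (shift a) ≡ f (shift b)) → f x ≡ f y
    periodic (a , b , a<b , fa≡fb) with toℕ b ∸ toℕ a <? r
    -- A gap below `r` violates the lower bound in `Far`, so the two points are adjacent yet share a
    -- color.
    ... | yes b∸a<r = ⊥-elim (proper (shift-≢ a<b)
            (λ (r≤d , _) → <⇒≱ b∸a<r (subst (r ≤_) (dist-shift a<b) r≤d)) fa≡fb)
    -- Indices in 0, ..., r with a gap of at least `r` must be 0 and `r`, which are the ends `x` and
    -- `y` of the window.
    ... | no  b∸a≮r = trans (sym (cong f shift-a≡x)) (trans fa≡fb (cong f shift-b≡y))
      where
      r≤b∸a : r ≤ toℕ b ∸ toℕ a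
      r≤b∸a = ≮⇒≥ b∸a≮r

      b≡r : toℕ b ≡ r
      b≡r = ≤-antisym (toℕ≤pred[n] b) (≤-trans r≤b∸a (m∸n≤m (toℕ b) (toℕ a)))

      a≡0 : toℕ a ≡ 0
      a≡0 = n≤0⇒n≡0 (+-cancelʳ-≤ (toℕ b ∸ toℕ a) _ _ (begin
        toℕ a + (toℕ b ∸ toℕ a)  ≡⟨ m+[n∸m]≡n (<⇒≤ a<b) ⟩
        toℕ b                    ≡⟨ b≡r ⟩
        r                        ≤⟨ r≤b∸a ⟩
        toℕ b ∸ toℕ a            ∎))
        where open ≤-Reasoning

      shift-a≡x : shift a ≡ x
      shift-a≡x = toℕ-injective
        (trans (toℕ-shift a) (trans (cong (toℕ x +_) a≡0) (+-identityʳ (toℕ x))))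

      shift-b≡y : shift b ≡ y
      shift-b≡y = toℕ-injective
        (trans (toℕ-shift b) (trans (cong (toℕ x +_) b≡r) (sym y≡x+r)))

  constant-on-multiples : ∀ j (x y : Fin n) → toℕ x ≡ 0 → toℕ y ≡ j * r → f x ≡ f y
  constant-on-multiples zero    x y x≡0 y≡0 = cong f (toℕ-injective (trans x≡0 (sym y≡0)))
  constant-on-multiples (suc j) x y x≡0 y≡r+jr =
    trans (constant-on-multiples j x z x≡0 z≡jr)
          (r-periodic z y (trans y≡r+jr (trans (+-comm r (j * r)) (cong (_+ r) (sym z≡jr)))))
    where
    -- The previous multiple of `r` lies at or below `y`, hence is again a point of `Fin n`.
    jr<n : j * r < n
    jr<n = ≤-<-trans (m≤n+m (j * r) r) (subst (_< n) y≡r+jr (toℕ<n y))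

    z    = fromℕ< jr<n
    z≡jr = toℕ-fromℕ< jr<n

-- The choice n = kr + 1 makes the last point a multiple of `r`, so it has the color of the first,
-- although the two are neighbors in the cyclic order.
not-proper : ∀ r k → r > 1 → k ≥ 1 → (f : Fin (k * r + 1) → Fin r) →
             ¬ (∀ {x y} → x ≢ y → ¬ Far r x y → f x ≢ f y)
not-proper r k r>1 k≥1 f proper =
  proper first≢last first-near-last
    (constant-on-multiples f proper k first last toℕ-first toℕ-last)
  where
  first last : Fin (k * r + 1)
  first = fromℕ< (m<n⇒0<n {n = k * r + 1} (m<m+n (k * r) z<s))
  last  = fromℕ< (m<m+n (k * r) z<s)

  toℕ-first : toℕ first ≡ 0
  toℕ-first = toℕ-fromℕ< _

  toℕ-last : toℕ last ≡ k * r
  toℕ-last = toℕ-fromℕ< _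

  first≢last : first ≢ last
  -- The product `1 * 1 ≤ k * r` computes to `0 < k * r`.
  first≢last eq = <⇒≢ (*-mono-≤ k≥1 (<⇒≤ r>1))
    (trans (sym toℕ-first) (trans (cong toℕ eq) toℕ-last))

  first-near-last : ¬ Far r first last
  -- Here the upper bound in `Far` fails: kr + r ≤ kr + 1 would give r ≤ 1.
  first-near-last (_ , d+r≤n) = <⇒≱ r>1 (+-cancelˡ-≤ (k * r) r 1
    (subst (λ d → d + r ≤ k * r + 1) (cong₂ ∣_-_∣ toℕ-first toℕ-last) d+r≤n))

-- Defect 0 would mean that the whole hypergraph is `r`-colorable, and such a coloring is a proper
-- coloring of the graph excluded by `not-proper`.
cd-nonstablePairs>0 : ∀ r k → r > 1 → k ≥ 1 →
                      0 < cd r (hypergraph (nonstablePairs (k * r + 1) r))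
cd-nonstablePairs>0 r k r>1 k≥1 = n≢0⇒n>0 λ cd≡0 → impossible
  (subst (ColorableAfterRemoving r H) cd≡0 (Minimum.attained (colorabilityDefect r H)))
  where
  H = hypergraph (nonstablePairs (k * r + 1) r)

  impossible : ¬ ColorableAfterRemoving r H 0
  impossible (R , _ , ∣R∣≡0 , c , isColoring) =
    not-proper r k r>1 k≥1 (λ x → c (x , kept x)) λ {x} {y} x≢y near eq →
      -- Vertices carry membership proofs. Irrelevance of these proofs makes the color depend on the
      -- point alone, so equal colors at `x` and `y` render the edge monochromatic.
      let value : ∀ {z} p → z ≡ x ⊎ z ≡ y → c (z , p) ≡ c (x , kept x)
          value = λ where
            p (inj₁ refl) → cong (λ q → c (_ , q)) ([]=-irrelevant p (kept _))
            p (inj₂ refl) → trans (cong (λ q → c (_ , q)) ([]=-irrelevant p (kept _))) (sym eq)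
          cases : ∀ {z} → z ∈ ⁅ x ⁆ ∪ ⁅ y ⁆ → z ≡ x ⊎ z ≡ y
          cases z∈ = map (x∈⁅y⁆⇒x≡y x) (x∈⁅y⁆⇒x≡y y) (x∈p∪q⁻ ⁅ x ⁆ ⁅ y ⁆ z∈)
      in isColoring (⁅ x ⁆ ∪ ⁅ y ⁆)
           (⁅x⁆∪⁅y⁆∈nonstablePairs r x≢y near , λ _ → kept _)
           λ (v , p) (w , q) v∈ w∈ → trans (value p (cases v∈)) (sym (value q (cases w∈)))
    where
    -- As `R` has no elements, `c` is defined at every point of the ground set.
    kept : ∀ x → x ∈ Hypergraph.V (remove H R)
    kept x = x∈p∧x∉q⇒x∈p─q ∈⊤ (∣p∣≡0⇒x∉p ∣R∣≡0)

χ<⌈cd/[r-1]⌉ : ∀ r k .{{_ : NonTrivial r}} → k ≥ 1 →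
  let F = nonstablePairs (k * r + 1) r in χ-KG r (stab r F) < ⌈ cd r (hypergraph F) /[ r -1]⌉
χ<⌈cd/[r-1]⌉ r k k≥1 = subst (_< ⌈ cd r (hypergraph F) /[ r -1]⌉)
  (sym (χ-KG-memberless r (stab r F) (stab-∖-stab r (pairs _))))
  (⌈/-1⌉>0 _ r (cd-nonstablePairs>0 r k (nonTrivial⇒n>1 r) k≥1))
  where
  F = nonstablePairs (k * r + 1) r

mainTheorem1 : (∀ r k .{{_ : NonTrivial r}} → r ≥ 3 → k ≥ 1 →
    let n = k * r + 1
        F = nonstablePairs n r
    in χ-KG r (stab r F) < ⌈ cd r (hypergraph F) /[ r -1]⌉)
    ×
    ¬ (∀ r .{{_ : NonTrivial r}} → r ≥ 3 → ∀ n (F : SetSystem n) →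
    χ-KG r (stab r F) ≥ ⌈ cd r (hypergraph F) /[ r -1]⌉)
mainTheorem1 =
  (λ r k _ k≥1 → χ<⌈cd/[r-1]⌉ r k k≥1) ,
  -- The smallest case r = 3, k = 1 refutes the bound, with 4 = 1 * 3 + 1.
  λ bound → <⇒≱ (χ<⌈cd/[r-1]⌉ 3 1 ≤-refl) (bound 3 ≤-refl 4 (nonstablePairs 4 3))
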